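{- Let $p$ be a prime, $q$ a power of $p$, $n\ge1$ odd, $m=\frac{q^n+1}{q+1}$. Let $\Sigma$ be the set of pairs $(H,M)$ such that $H\le A(P_\infty)$ and $M\le\mu$ are subgroups with $M^m:=\{d^m:d\in M\}=\phi(H)$. For a subgroup $G\le B(Q_\infty)$ set $\Xi(G)=(\pi(G),\pi_d(G))$. Then $\Xi$ is a bijection from the set of subgroups of $B(Q_\infty)$ onto $\Sigma$.
   Context: Let $\mathcal C_n=\mathbb{F}_{q^{2n}}(x,y,z)$ be the function field defined by $x^q+x=y^{q+1}$ and $z^m=y^{q^2}-y$. Let $A(P_\infty)$ be the group of symbols $[a,b,c]$ with $a\in\mathbb{F}_{q^2}^*$, $b,c\in\mathbb{F}_{q^2}$, $c^q+c=b^{q+1}$, with group law $[a',b',c']\circ[a,b,c]=[a'a,ab'+b,a^{q+1}c'+ab^qb'+c]$ (the automorphisms $x\mapsto a^{q+1}x+ab^qy+c$, $y\mapsto ay+b$ of the Hermitian function field $\mathbb{F}_{q^2}(x,y)$), and $\phi:A(P_\infty)\to\mathbb{F}_{q^2}^*$, $[a,b,c]\mapsto a$. Let $B(Q_\infty)$ be the group of automorphisms $[a,b,c,d]$ of $\mathcal C_n$ given by $x\mapsto a^{q+1}x+ab^qy+c$, $y\mapsto ay+b$, $z\mapsto dz$, where $a\in\mathbb{F}_{q^2}^*$, $b,c\in\mathbb{F}_{q^2}$, $c^q+c=b^{q+1}$, $d\in\mathbb{F}_{q^{2n}}$, $d^m=a$; its group law is $[a',b',c',d']\circ[a,b,c,d]=[a'a,ab'+b,a^{q+1}c'+ab^qb'+c,d'd]$.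 Let $\mu\le\mathbb{F}_{q^{2n}}^*$ be the group of $(q^n+1)(q-1)$-th roots of unity. Define $\pi:B(Q_\infty)\to A(P_\infty)$, $[a,b,c,d]\mapsto[a,b,c]$, and $\pi_d:B(Q_\infty)\to\mu$, $[a,b,c,d]\mapsto d$. -}

module Defs where

open import Level using (Level; _⊔_) renaming (suc to lsuc)
open import Algebra.Bundles using (CommutativeRing; Group)
open import Algebra.Apartness.Bundles using (HeytingField; HeytingCommutativeRing)
open import Algebra.Morphism.Structures using (IsGroupHomomorphism; IsRingMonomorphism)
open import Data.Nat.Base as ℕ using (ℕ; zero; suc; _∸_; s≤s; z≤n)
import Data.Nat.Properties as ℕ
open import Data.Nat.Combinatorics using (_C_; nCk≡n!/k![n-k]!; k![n∸k]!∣n!; nCn≡1)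
open import Data.Nat.Divisibility
  using (_∣_; divides; ∣⇒≤; ∣m+n∣m⇒∣n; m∣m*n; n∣m*n; ∣-trans; ∣-reflexive; _∣0; ∣m∣n⇒∣m+n; ∣-refl)
open import Data.Nat.DivMod using (_/_; m/n*n≡m)
open import Data.Nat.Primality using (Prime; euclidsLemma; prime⇒nonTrivial)
open import Data.Nat.Solver using (module +-*-Solver)
open import Data.Fin.Base as Fin using (Fin; toℕ; punchIn; fromℕ)
import Data.Fin.Properties as Fin
open import Data.Fin.Permutation as Perm using (Permutation)
open import Data.Product.Base using (∃-syntax; _×_; _,_; proj₁; proj₂)
open import Data.Sum.Base using (inj₁; inj₂)
open import Data.Vec.Functional using (replicate; removeAt; init)
open import Function.Base using (_∘_; _$_)
open import Function.Bundles using (Inverse)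
open import Relation.Binary.Core using (Rel)
open import Relation.Binary.Definitions using (Decidable; _Respects_)
open import Relation.Binary.PropositionalEquality as ≡ using (_≡_; _≢_)
import Relation.Binary.Reasoning.Setoid as ≈-Reasoning
open import Relation.Nullary using (¬_; yes; no; contradiction)
open import Relation.Unary using (Pred; _≐_)

private variable
  u ℓ u′ ℓ′ r : Level

-- A field with exactly N elements.  Its equality is decidable by finiteness, so the
-- apartness x # y amounts to x ≉ y; a # 0# says that a is a nonzero element.
record FiniteField u ℓ (N : ℕ) : Set (lsuc (u ⊔ ℓ)) where
  field
    heytingField : HeytingField u ℓ ℓ

  open HeytingField heytingField public using (_#_; tight; heytingCommutativeRing)
  open HeytingCommutativeRing heytingCommutativeRing public
    using (commutativeRing; #⇒invertible)
  open CommutativeRing commutativeRing public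

  field
    enumeration : Inverse (≡.setoid (Fin N)) setoid

  open import Algebra.Properties.Semiring.Exp semiring public using (_^_)

-- A subgroup is a predicate on elements; equality of subgroups is _≈ˢ_, having the same members.
record Subgroup (G : Group u ℓ) r : Set (u ⊔ ℓ ⊔ lsuc r) where
  open Group G
  field
    Member    : Pred Carrier r
    resp      : Member Respects _≈_
    ε-closed  : Member ε
    ∙-closed  : ∀ {x y} → Member x → Member y → Member (x ∙ y)
    ⁻¹-closed : ∀ {x} → Member x → Member (x ⁻¹)

open Subgroup public

infix 4 _≈ˢ_
_≈ˢ_ : {G : Group u ℓ} → Rel (Subgroup G r) (u ⊔ r)
H ≈ˢ K = Member H ≐ Member K

module _ (G : Group u ℓ) (H : Group u′ ℓ′) where
  private
    module G = Group G
    module H = Group H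

  image : (f : G.Carrier → H.Carrier) → IsGroupHomomorphism G.rawGroup H.rawGroup f →
          Subgroup G r → Subgroup H (u ⊔ ℓ′ ⊔ r)
  image f f-homo S = record
    { Member    = λ y → ∃[ x ] (Member S x × f x H.≈ y)
    ; resp      = λ { y≈z (x , x∈S , fx≈y) → x , x∈S , H.trans fx≈y y≈z }
    ; ε-closed  = G.ε , ε-closed S , ε-homo
    ; ∙-closed  = λ { (x , x∈S , fx≈y) (x′ , x′∈S , fx′≈y′) →
        x G.∙ x′ , ∙-closed S x∈S x′∈S , H.trans (homo x x′) (H.∙-cong fx≈y fx′≈y′) }
    ; ⁻¹-closed = λ { (x , x∈S , fx≈y) →
        x G.⁻¹ , ⁻¹-closed S x∈S , H.trans (⁻¹-homo x) (H.⁻¹-cong fx≈y) }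
    }
    where open IsGroupHomomorphism f-homo

prime∣!⇒≤ : ∀ {p} → Prime p → ∀ m → p ∣ m ℕ.! → p ℕ.≤ m
prime∣!⇒≤ {p} p-prime zero p∣1 =
  contradiction (∣⇒≤ p∣1) (ℕ.<⇒≱ (ℕ.nonTrivial⇒n>1 p {{prime⇒nonTrivial p-prime}}))
prime∣!⇒≤ p-prime (suc m) p∣ with euclidsLemma (suc m) (m ℕ.!) p-prime p∣
... | inj₁ p∣1+m = ∣⇒≤ p∣1+m
... | inj₂ p∣m!  = ℕ.m≤n⇒m≤1+n (prime∣!⇒≤ p-prime m p∣m!)

prime∣C : ∀ {p k} → Prime p → 0 ℕ.< k → k ℕ.< p → p ∣ p C k
prime∣C {p@(suc p-1)} {k@(suc k-1)} p-prime 0<k k<p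
  with euclidsLemma (p C k) (k ℕ.! ℕ.* (p ∸ k) ℕ.!) p-prime p∣C*d
  where
  p∣C*d : p ∣ (p C k) ℕ.* (k ℕ.! ℕ.* (p ∸ k) ℕ.!)
  p∣C*d = ∣-trans (m∣m*n (p-1 ℕ.!)) (∣-reflexive (≡.sym (≡.trans
    (≡.cong (ℕ._* (k ℕ.! ℕ.* (p ∸ k) ℕ.!)) (nCk≡n!/k![n-k]! (ℕ.<⇒≤ k<p)))
    (m/n*n≡m {{ k ℕ.!* (p ∸ k) !≢0 }} (k![n∸k]!∣n! (ℕ.<⇒≤ k<p))))))
... | inj₁ p∣C = p∣C
... | inj₂ p∣d with euclidsLemma (k ℕ.!) ((p ∸ k) ℕ.!) p-prime p∣d
...   | inj₁ p∣k!     = contradiction (prime∣!⇒≤ p-prime k p∣k!) (ℕ.<⇒≱ k<p)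
...   | inj₂ p∣[p-k]! =
  contradiction (prime∣!⇒≤ p-prime (p ∸ k) p∣[p-k]!) (ℕ.<⇒≱ (s≤s (ℕ.m∸n≤m p-1 k-1)))

1+q∣qⁿ+1 : ∀ q n → ¬ 2 ∣ n → 1 ℕ.+ q ∣ q ℕ.^ n ℕ.+ 1
1+q∣qⁿ+1 q zero          n-odd = contradiction (2 ∣0) n-odd
1+q∣qⁿ+1 q (suc zero)    n-odd =
  ∣-reflexive (solve 1 (λ q → con 1 :+ q := q :* con 1 :+ con 1) ≡.refl q)
  where open +-*-Solver
1+q∣qⁿ+1 q (suc (suc n)) n-odd =
  ∣m+n∣m⇒∣n
    (≡.subst (1 ℕ.+ q ∣_) (rearrange q (q ℕ.^ n))
      (∣m∣n⇒∣m+n (m∣m*n (q ℕ.* q ℕ.^ n)) (1+q∣qⁿ+1 q n (n-odd ∘ ∣m∣n⇒∣m+n ∣-refl))))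
    (m∣m*n (q ℕ.^ n))
  where
  open +-*-Solver
  rearrange : ∀ q x → (1 ℕ.+ q) ℕ.* (q ℕ.* x) ℕ.+ (x ℕ.+ 1) ≡
                      (1 ℕ.+ q) ℕ.* x ℕ.+ (q ℕ.* (q ℕ.* x) ℕ.+ 1)
  rearrange = solve 2 (λ q x → (con 1 :+ q) :* (q :* x) :+ (x :+ con 1) :=
                               (con 1 :+ q) :* x :+ (q :* (q :* x) :+ con 1)) ≡.refl

module FiniteFieldProperties {N} (𝔽 : FiniteField u ℓ N) where
  open FiniteField 𝔽
  open Inverse enumeration renaming (to to elem; from to index) using (strictlyInverseˡ; strictlyInverseʳ; from-cong)
  open import Algebra.Apartness.Properties.HeytingCommutativeRing heytingCommutativeRing public
    using (x#0y#0→xy#0; #-congʳ; 1#0; x-0≈x; invertibleˡ⇒#)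
  open import Algebra.Properties.CommutativeSemiring.Exp commutativeSemiring public hiding (_^_)
  open import Algebra.Properties.Semiring.Mult semiring public using ()
    renaming (_×_ to _⋆_; ×-assoc-* to ⋆-assoc-*; ×1-homo-* to ⋆1-homo-*; ×-congʳ to ⋆-congʳ; ×-congˡ to ⋆-congˡ; ×-homo-1 to ⋆-homo-1)
  open import Algebra.Properties.CommutativeMonoid.Sum +-commutativeMonoid
    using (sum; sum-cong-≋; sum-init-last; sum-replicate; sum-replicate-zero; ∑-distrib-+; sum-permute)
  open import Algebra.Properties.CommutativeMonoid.Sum *-commutativeMonoid using ()
    renaming (sum to prod; sum-cong-≋ to prod-cong; sum-remove to prod-remove;
              sum-replicate to prod-replicate; ∑-distrib-+ to prod-distrib-*; sum-permute to prod-permute;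
              sum-replicate-zero to prod-replicate-one)
  open import Algebra.Properties.CommutativeSemiring.Binomial commutativeSemiring
    using (binomialTerm) renaming (theorem to binomial-theorem)
  open import Algebra.Properties.Group +-group using ()
    renaming (∙-cancelˡ to +-cancelˡ; identityʳ-unique to +-identityʳ-unique; inverseʳ-unique to -‿unique)
  open import Algebra.Properties.Ring ring using (-‿distribˡ-*)
  open ≈-Reasoning setoid

  infixl 8 _⁻¹⟨_⟩
  _⁻¹⟨_⟩ : ∀ x → x # 0# → Carrier
  x ⁻¹⟨ x#0 ⟩ = proj₁ (#⇒invertible x#0)

  ⁻¹-inverseˡ : ∀ {x} (x#0 : x # 0#) → x ⁻¹⟨ x#0 ⟩ * x ≈ 1#
  ⁻¹-inverseˡ {x} x#0 =
    trans (*-congˡ (sym (x-0≈x x))) (proj₁ (proj₂ (#⇒invertible x#0)))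

  ⁻¹-inverseʳ : ∀ {x} (x#0 : x # 0#) → x * x ⁻¹⟨ x#0 ⟩ ≈ 1#
  ⁻¹-inverseʳ x#0 = trans (*-comm _ _) (⁻¹-inverseˡ x#0)

  yx≈1⇒x#0 : ∀ {x y} → y * x ≈ 1# → x # 0#
  yx≈1⇒x#0 {x} {y} yx≈1 = invertibleˡ⇒# (y , trans (*-congˡ (x-0≈x x)) yx≈1)

  ⁻¹-#0 : ∀ {x} (x#0 : x # 0#) → x ⁻¹⟨ x#0 ⟩ # 0#
  ⁻¹-#0 x#0 = yx≈1⇒x#0 (⁻¹-inverseʳ x#0)

  *-cancelˡ : ∀ {x y z} → x # 0# → x * y ≈ x * z → y ≈ z
  *-cancelˡ {x} {y} {z} x#0 xy≈xz = begin
    y              ≈⟨ expand y ⟨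
    x⁻¹ * (x * y)  ≈⟨ *-congˡ xy≈xz ⟩
    x⁻¹ * (x * z)  ≈⟨ expand z ⟩
    z              ∎
    where
    x⁻¹ = x ⁻¹⟨ x#0 ⟩
    expand : ∀ w → x⁻¹ * (x * w) ≈ w
    expand w = trans (sym (*-assoc _ _ _)) (trans (*-congʳ (⁻¹-inverseˡ x#0)) (*-identityˡ w))

  ⁻¹-cong : ∀ {x y} (x#0 : x # 0#) (y#0 : y # 0#) → x ≈ y → x ⁻¹⟨ x#0 ⟩ ≈ y ⁻¹⟨ y#0 ⟩
  ⁻¹-cong x#0 y#0 x≈y = *-cancelˡ x#0
    (trans (⁻¹-inverseʳ x#0) (sym (trans (*-congʳ x≈y) (⁻¹-inverseʳ y#0))))

  #⇒≉ : ∀ {x y} → x # y → ¬ x ≈ y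
  #⇒≉ {x} {y} x#y x≈y = proj₂ (tight x y) x≈y x#y

  infix 4 _≟_
  _≟_ : Decidable _≈_
  x ≟ y with index x Fin.≟ index y
  ... | yes i≡j = yes (trans (sym (strictlyInverseˡ x)) (trans (reflexive (≡.cong elem i≡j)) (strictlyInverseˡ y)))
  ... | no  i≢j = no (i≢j ∘ from-cong)

  ≉0⇒#0 : ∀ {x} → ¬ x ≈ 0# → x # 0#
  ≉0⇒#0 {x} x≉0 with Fin.any? (λ i → elem i * x ≟ 1#)
  ... | yes (i , yx≈1) = yx≈1⇒x#0 yx≈1
  ... | no  ¬inv       = contradiction (proj₁ (tight x 0#) λ x#0 → ¬inv
    (index (x ⁻¹⟨ x#0 ⟩) , trans (*-congʳ (strictlyInverseˡ _)) (⁻¹-inverseˡ x#0))) x≉0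

  ^-#0 : ∀ {x} n → x # 0# → x ^ n # 0#
  ^-#0 zero    x#0 = 1#0
  ^-#0 (suc n) x#0 = x#0y#0→xy#0 x#0 (^-#0 n x#0)

  x^n≈0⇒x≈0 : ∀ {x} n → x ^ n ≈ 0# → x ≈ 0#
  x^n≈0⇒x≈0 {x} n xⁿ≈0 with x ≟ 0#
  ... | yes x≈0 = x≈0
  ... | no  x≉0 = contradiction xⁿ≈0 (#⇒≉ (^-#0 n (≉0⇒#0 x≉0)))

  1^n≈1 : ∀ n → 1# ^ n ≈ 1#
  1^n≈1 zero    = refl
  1^n≈1 (suc n) = trans (*-identityˡ _) (1^n≈1 n)

  0^n≈0 : ∀ {n} → 0 ℕ.< n → 0# ^ n ≈ 0#
  0^n≈0 {suc n} _ = zeroˡ _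

  permute : (f g : Carrier → Carrier) → (∀ {x y} → x ≈ y → f x ≈ f y) → (∀ {x y} → x ≈ y → g x ≈ g y) →
            (∀ x → f (g x) ≈ x) → (∀ x → g (f x) ≈ x) → Permutation N N
  permute f g f-cong g-cong fg gf = Perm.permutation (λ i → index (f (elem i))) (λ i → index (g (elem i)))
    (λ i → ≡.trans (from-cong (trans (f-cong (strictlyInverseˡ _)) (fg (elem i)))) (strictlyInverseʳ i))
    (λ i → ≡.trans (from-cong (trans (g-cong (strictlyInverseˡ _)) (gf (elem i)))) (strictlyInverseʳ i))

  N⋆1≈0 : N ⋆ 1# ≈ 0#
  N⋆1≈0 = +-identityʳ-unique (sum elem) (N ⋆ 1#) $ begin
    sum elem + N ⋆ 1#                ≈⟨ +-congˡ (sum-replicate N) ⟨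
    sum elem + sum (replicate N 1#)  ≈⟨ ∑-distrib-+ elem (replicate N 1#) ⟨
    sum (λ i → elem i + 1#)          ≈⟨ sum-cong-≋ (λ i → strictlyInverseˡ (elem i + 1#)) ⟨
    sum (elem ∘ (Perm._⟨$⟩ʳ_ shift)) ≈⟨ sum-permute elem shift ⟨
    sum elem                         ∎
    where
    shift : Permutation N N
    shift = permute (_+ 1#) (_+ - 1#) +-congʳ +-congʳ
      (λ x → trans (+-assoc _ _ _) (trans (+-congˡ (-‿inverseˡ 1#)) (+-identityʳ x)))
      (λ x → trans (+-assoc _ _ _) (trans (+-congˡ (-‿inverseʳ 1#)) (+-identityʳ x)))

  private
    ifZero : (x u v : Carrier) → Carrier
    ifZero x u v with x ≟ 0#
    ... | yes _ = u
    ... | no  _ = v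

    ifZero-yes : ∀ {x u v} → x ≈ 0# → ifZero x u v ≈ u
    ifZero-yes {x} x≈0 with x ≟ 0#
    ... | yes _   = refl
    ... | no  x≉0 = contradiction x≈0 x≉0

    ifZero-no : ∀ {x u v} → ¬ x ≈ 0# → ifZero x u v ≈ v
    ifZero-no {x} x≉0 with x ≟ 0#
    ... | yes x≈0 = contradiction x≈0 x≉0
    ... | no  _   = refl

    prod-#0 : ∀ {n} (f : Fin n → Carrier) → (∀ i → f i # 0#) → prod f # 0#
    prod-#0 {zero}  f f#0 = 1#0
    prod-#0 {suc n} f f#0 = x#0y#0→xy#0 (f#0 Fin.zero) (prod-#0 (f ∘ Fin.suc) (f#0 ∘ Fin.suc))

    prod-single : ∀ {n} (f : Fin n → Carrier) i → (∀ j → j ≢ i → f j ≈ 1#) → prod f ≈ f i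
    prod-single {suc n} f i f≈1 = begin
      prod f                         ≈⟨ prod-remove {i = i} f ⟩
      f i * prod (removeAt f i)      ≈⟨ *-congˡ (prod-cong (λ j → f≈1 (punchIn i j) (Fin.punchInᵢ≢i i j))) ⟩
      f i * prod (replicate n 1#)    ≈⟨ *-congˡ (prod-replicate-one n) ⟩
      f i * 1#                       ≈⟨ *-identityʳ _ ⟩
      f i                            ∎

  -- Multiplication by a permutes the elements and fixes 0#; f replaces the factor 0# by 1#,
  -- and h compensates for it.
  x#0⇒xᴺ≈x : ∀ {a} → a # 0# → a ^ N ≈ a
  x#0⇒xᴺ≈x {a} a#0 = *-cancelˡ (prod-#0 f f#0) $ begin
    prod f * a ^ N                     ≈⟨ *-comm _ _ ⟩
    a ^ N * prod f                     ≈⟨ *-congʳ (prod-replicate N) ⟨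
    prod (replicate N a) * prod f      ≈⟨ prod-distrib-* (replicate N a) f ⟨
    prod (λ i → a * f i)               ≈⟨ prod-cong pointwise ⟨
    prod (λ i → f (scale Perm.⟨$⟩ʳ i) * h i) ≈⟨ prod-distrib-* _ h ⟩
    prod (f ∘ (scale Perm.⟨$⟩ʳ_)) * prod h   ≈⟨ *-cong (sym (prod-permute f scale)) prod-h ⟩
    prod f * a                         ∎
    where
    f h : Fin N → Carrier
    f i = ifZero (elem i) 1# (elem i)
    h i = ifZero (elem i) a 1#

    f#0 : ∀ i → f i # 0#
    f#0 i with elem i ≟ 0#
    ... | yes _   = 1#0
    ... | no  x≉0 = ≉0⇒#0 x≉0

    a⁻¹ = a ⁻¹⟨ a#0 ⟩

    scale : Permutation N N
    scale = permute (a *_) (a⁻¹ *_) *-congˡ *-congˡ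
      (λ x → trans (sym (*-assoc _ _ _)) (trans (*-congʳ (⁻¹-inverseʳ a#0)) (*-identityˡ x)))
      (λ x → trans (sym (*-assoc _ _ _)) (trans (*-congʳ (⁻¹-inverseˡ a#0)) (*-identityˡ x)))

    pointwise : ∀ i → f (scale Perm.⟨$⟩ʳ i) * h i ≈ a * f i
    pointwise i with elem i ≟ 0#
    ... | yes x≈0 = trans (*-congʳ (ifZero-yes (trans (strictlyInverseˡ _) (trans (*-congˡ x≈0) (zeroʳ a)))))
                          (*-comm _ _)
    ... | no  x≉0 = trans (*-identityʳ _) (trans (ifZero-no ax≉0) (strictlyInverseˡ _))
      where
      ax≉0 : ¬ elem (scale Perm.⟨$⟩ʳ i) ≈ 0#
      ax≉0 ax≈0 = #⇒≉ (x#0y#0→xy#0 a#0 (≉0⇒#0 x≉0)) (trans (sym (strictlyInverseˡ _)) ax≈0)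

    prod-h : prod h ≈ a
    prod-h = trans
      (prod-single h (index 0#) λ j j≢0 → ifZero-no λ x≈0 →
        j≢0 (≡.trans (≡.sym (strictlyInverseʳ j)) (from-cong x≈0)))
      (ifZero-yes (strictlyInverseˡ 0#))

  xᴺ≈x : 0 ℕ.< N → ∀ x → x ^ N ≈ x
  xᴺ≈x 0<N x with x ≟ 0#
  ... | yes x≈0 = trans (^-congˡ N x≈0) (trans (0^n≈0 0<N) (sym x≈0))
  ... | no  x≉0 = x#0⇒xᴺ≈x (≉0⇒#0 x≉0)

  ⋆1-homo-^ : ∀ m n → (m ℕ.^ n) ⋆ 1# ≈ (m ⋆ 1#) ^ n
  ⋆1-homo-^ m zero    = ⋆-homo-1 1#
  ⋆1-homo-^ m (suc n) = trans (⋆1-homo-* m (m ℕ.^ n)) (*-congˡ (⋆1-homo-^ m n))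

  module Frobenius {p} (p-prime : Prime p) (p⋆1≈0 : p ⋆ 1# ≈ 0#) where

    p∣n⇒n⋆x≈0 : ∀ {n} x → p ∣ n → n ⋆ x ≈ 0#
    p∣n⇒n⋆x≈0 x (divides d ≡.refl) = begin
      (d ℕ.* p) ⋆ x              ≈⟨ ⋆-congʳ (d ℕ.* p) (*-identityˡ x) ⟨
      (d ℕ.* p) ⋆ (1# * x)       ≈⟨ ⋆-assoc-* (d ℕ.* p) 1# x ⟨
      (d ℕ.* p) ⋆ 1# * x         ≈⟨ *-congʳ (⋆1-homo-* d p) ⟩
      (d ⋆ 1#) * (p ⋆ 1#) * x    ≈⟨ *-congʳ (trans (*-congˡ p⋆1≈0) (zeroʳ _)) ⟩
      0# * x                     ≈⟨ zeroˡ x ⟩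
      0#                         ∎

    ^p-homo-+ : ∀ x y → (x + y) ^ p ≈ x ^ p + y ^ p
    ^p-homo-+ = lemma p p-prime p∣n⇒n⋆x≈0
      where
      lemma : ∀ p → Prime p → (∀ {n} x → p ∣ n → n ⋆ x ≈ 0#) → ∀ x y → (x + y) ^ p ≈ x ^ p + y ^ p
      lemma p@(suc p-1) p-prime p∣n⇒n⋆x≈0 x y = begin
        (x + y) ^ p                              ≈⟨ binomial-theorem p x y ⟩
        t Fin.zero + sum (t ∘ Fin.suc)           ≈⟨ +-cong first (sum-init-last (t ∘ Fin.suc)) ⟩
        y ^ p + (sum (init (t ∘ Fin.suc)) + t (fromℕ p))
          ≈⟨ +-congˡ (+-cong (trans (sum-cong-≋ middle) (sum-replicate-zero p-1)) last) ⟩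
        y ^ p + (0# + x ^ p)                     ≈⟨ +-congˡ (+-identityˡ _) ⟩
        y ^ p + x ^ p                            ≈⟨ +-comm _ _ ⟩
        x ^ p + y ^ p                            ∎
        where
        t = binomialTerm x y p

        first : t Fin.zero ≈ y ^ p
        first = trans (⋆-homo-1 _) (*-identityˡ _)

        last : t (fromℕ p) ≈ x ^ p
        last = begin
          (p C toℕ (fromℕ p)) ⋆ (x ^ toℕ (fromℕ p) * y ^ (p ∸ toℕ (fromℕ p)))
            ≡⟨ ≡.cong (λ i → (p C i) ⋆ (x ^ i * y ^ (p ∸ i))) (Fin.toℕ-fromℕ p) ⟩
          (p C p) ⋆ (x ^ p * y ^ (p ∸ p))
            ≡⟨ ≡.cong₂ (λ i j → i ⋆ (x ^ p * y ^ j)) (nCn≡1 p) (ℕ.n∸n≡0 p) ⟩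
          1 ⋆ (x ^ p * 1#)   ≈⟨ ⋆-homo-1 _ ⟩
          x ^ p * 1#         ≈⟨ *-identityʳ _ ⟩
          x ^ p              ∎

        middle : ∀ i → init (t ∘ Fin.suc) i ≈ 0#
        middle i = p∣n⇒n⋆x≈0 _ (prime∣C p-prime (s≤s z≤n)
          (s≤s (≡.subst (ℕ._< p-1) (≡.sym (Fin.toℕ-inject₁ i)) (Fin.toℕ<n i))))

    ^pᵏ-homo-+ : ∀ k x y → (x + y) ^ (p ℕ.^ k) ≈ x ^ (p ℕ.^ k) + y ^ (p ℕ.^ k)
    ^pᵏ-homo-+ zero    x y = trans (*-identityʳ _) (sym (+-cong (*-identityʳ x) (*-identityʳ y)))
    ^pᵏ-homo-+ (suc k) x y = begin
      (x + y) ^ (p ℕ.* p ℕ.^ k)                      ≈⟨ ^-assocʳ _ p _ ⟨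
      ((x + y) ^ p) ^ (p ℕ.^ k)                      ≈⟨ ^-congˡ (p ℕ.^ k) (^p-homo-+ x y) ⟩
      (x ^ p + y ^ p) ^ (p ℕ.^ k)                    ≈⟨ ^pᵏ-homo-+ k _ _ ⟩
      (x ^ p) ^ (p ℕ.^ k) + (y ^ p) ^ (p ℕ.^ k)      ≈⟨ +-cong (^-assocʳ x p _) (^-assocʳ y p _) ⟩
      x ^ (p ℕ.* p ℕ.^ k) + y ^ (p ℕ.* p ℕ.^ k)      ∎

-- 𝔽 is the field of q² elements, 𝕂 the field of q²ⁿ elements, and ι the inclusion 𝔽 ⊆ 𝕂.
-- With m = (qⁿ+1)/(q+1), the function field in question is 𝕂(x,y,z), where
-- x^q + x = y^(q+1) and z^m = y^(q²) - y.
module HermitianTower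
  {p k q n : ℕ} (p-prime : Prime p) (1≤k : 1 ℕ.≤ k) (q≡pᵏ : q ≡ p ℕ.^ k) (n-odd : ¬ 2 ∣ n)
  (𝔽 : FiniteField u ℓ (q ℕ.^ 2)) (𝕂 : FiniteField u ℓ (q ℕ.^ (2 ℕ.* n)))
  (ι : FiniteField.Carrier 𝔽 → FiniteField.Carrier 𝕂)
  (ι-mono : IsRingMonomorphism (FiniteField.rawRing 𝔽) (FiniteField.rawRing 𝕂) ι)
  where

  private
    module F = FiniteFieldProperties 𝔽
    module K where
      open FiniteField 𝕂 public
      open FiniteFieldProperties 𝕂 public

  -- The division is exact because n is odd (m*[1+q]≡qⁿ+1).
  m : ℕ
  m = (q ℕ.^ n ℕ.+ 1) / (1 ℕ.+ q)

  |μ| : ℕ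
  |μ| = (q ℕ.^ n ℕ.+ 1) ℕ.* (q ∸ 1)

  1<q : 1 ℕ.< q
  1<q = ≡.subst (1 ℕ.<_) (≡.sym q≡pᵏ)
    (ℕ.<-≤-trans (ℕ.nonTrivial⇒n>1 p {{p-nonTrivial}})
      (≡.subst (ℕ._≤ p ℕ.^ k) (ℕ.^-identityʳ p) (ℕ.^-monoʳ-≤ p {{ℕ.nonTrivial⇒nonZero p {{p-nonTrivial}}}} 1≤k)))
    where p-nonTrivial = prime⇒nonTrivial p-prime

  0<q : 0 ℕ.< q
  0<q = ℕ.<⇒≤ 1<q

  m*[1+q]≡qⁿ+1 : m ℕ.* (1 ℕ.+ q) ≡ q ℕ.^ n ℕ.+ 1
  m*[1+q]≡qⁿ+1 = m/n*n≡m (1+q∣qⁿ+1 q n n-odd)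

  q²≡1+[1+q][q-1] : q ℕ.^ 2 ≡ suc ((1 ℕ.+ q) ℕ.* (q ∸ 1))
  q²≡1+[1+q][q-1] = lemma q 0<q
    where
    open +-*-Solver
    lemma : ∀ q → 0 ℕ.< q → q ℕ.^ 2 ≡ suc ((1 ℕ.+ q) ℕ.* (q ∸ 1))
    lemma (suc r) _ = solve 1 (λ r → (con 1 :+ r) :* ((con 1 :+ r) :* con 1) :=
                                     con 1 :+ (con 2 :+ r) :* r) ≡.refl r

  suc[|μ|-1]≡|μ| : suc (|μ| ∸ 1) ≡ |μ|
  suc[|μ|-1]≡|μ| = ℕ.m+[n∸m]≡n (ℕ.*-mono-≤ (ℕ.m≤n+m 1 (q ℕ.^ n)) (ℕ.∸-monoˡ-≤ 1 1<q))

  open FiniteField 𝔽 hiding (refl; sym; trans)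
  open FiniteField 𝔽 using () renaming (refl to ≈-refl; sym to ≈-sym; trans to ≈-trans)
  open FiniteFieldProperties 𝔽 using (_⁻¹⟨_⟩)

  private
    open import Algebra.Solver.Ring.NaturalCoefficients.Default (CommutativeRing.commutativeSemiring commutativeRing)
    open import Algebra.Properties.Ring ring using (-‿distribˡ-*; -‿distribʳ-*; -0#≈0#)
    open import Algebra.Properties.Group +-group using () renaming (inverseˡ-unique to -‿uniqueˡ)

    p⋆1≈0 : p F.⋆ 1# ≈ 0#
    p⋆1≈0 = F.x^n≈0⇒x≈0 k (≈-trans (≈-sym (F.⋆1-homo-^ p k))
      (≡.subst (λ q → q F.⋆ 1# ≈ 0#) q≡pᵏ
        (F.x^n≈0⇒x≈0 2 (≈-trans (≈-sym (F.⋆1-homo-^ q 2)) F.N⋆1≈0))))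

  ^q-homo-+ : ∀ x y → (x + y) ^ q ≈ x ^ q + y ^ q
  ^q-homo-+ x y = ≡.subst (λ q → (x + y) ^ q ≈ x ^ q + y ^ q) (≡.sym q≡pᵏ)
    (F.Frobenius.^pᵏ-homo-+ p-prime p⋆1≈0 k x y)

  ^q-homo-* : ∀ x y → (x * y) ^ q ≈ x ^ q * y ^ q
  ^q-homo-* x y = F.^-distrib-* x y q

  ^q-cong : ∀ {x y} → x ≈ y → x ^ q ≈ y ^ q
  ^q-cong = F.^-congˡ q

  0^q≈0 : 0# ^ q ≈ 0#
  0^q≈0 = F.0^n≈0 0<q

  ^q^q : ∀ x → (x ^ q) ^ q ≈ x
  ^q^q x = ≈-trans (F.^-assocʳ x q q)
    (≈-trans (F.^-congʳ x (≡.cong (q ℕ.*_) (≡.sym (ℕ.*-identityʳ q)))) (F.xᴺ≈x 0<q² x))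
    where
    0<q² : 0 ℕ.< q ℕ.^ 2
    0<q² = ≡.subst (0 ℕ.<_) (≡.sym q²≡1+[1+q][q-1]) (s≤s z≤n)

  ^q-homo-neg : ∀ x → (- x) ^ q ≈ - (x ^ q)
  ^q-homo-neg x = -‿uniqueˡ _ _
    (≈-trans (≈-sym (^q-homo-+ (- x) x)) (≈-trans (^q-cong (-‿inverseˡ x)) 0^q≈0))

  a#0⇒a^[q²-1]≈1 : ∀ {a} → a # 0# → a ^ ((1 ℕ.+ q) ℕ.* (q ∸ 1)) ≈ 1#
  a#0⇒a^[q²-1]≈1 {a} a#0 = F.*-cancelˡ a#0 (≈-trans
    (F.^-congʳ a (≡.sym q²≡1+[1+q][q-1])) (≈-trans (F.x#0⇒xᴺ≈x a#0) (≈-sym (*-identityʳ a))))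

  -- The symbol [a,b,c] stands for the automorphism x ↦ a^(q+1) x + a b^q y + c, y ↦ a y + b
  -- of the Hermitian function field 𝔽(x,y).
  record SymbolA : Set (u ⊔ ℓ) where
    field
      a b c : Carrier
      a#0   : a # 0#
      curve : c ^ q + c ≈ b ^ (1 ℕ.+ q)

  private
    module _ (g : SymbolA) where
      open SymbolA g

      inv : SymbolA
      inv = record
        { a = e
        ; b = - (e * b)
        ; c = e ^ (1 ℕ.+ q) * c ^ q
        ; a#0 = F.⁻¹-#0 a#0
        ; curve = begin
            (e * e ^ q * c ^ q) ^ q + e * e ^ q * c ^ q
              ≈⟨ +-congʳ (≈-trans (^q-homo-* _ _) (*-cong (≈-trans (^q-homo-* _ _) (*-congˡ (^q^q e))) (^q^q c))) ⟩
            e ^ q * e * c + e * e ^ q * c ^ q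
              ≈⟨ solve 4 (λ e ē c c̄ → ē :* e :* c :+ e :* ē :* c̄ := e :* ē :* (c̄ :+ c)) ≈-refl e (e ^ q) c (c ^ q) ⟩
            e * e ^ q * (c ^ q + c)
              ≈⟨ *-congˡ curve ⟩
            e * e ^ q * (b * b ^ q)
              ≈⟨ solve 4 (λ e ē b b̄ → e :* ē :* (b :* b̄) := e :* b :* (ē :* b̄)) ≈-refl e (e ^ q) b (b ^ q) ⟩
            e * b * (e ^ q * b ^ q)
              ≈⟨ neg*neg _ _ ⟨
            - (e * b) * - (e ^ q * b ^ q)
              ≈⟨ *-congˡ (≈-trans (^q-homo-neg _) (-‿cong (^q-homo-* e b))) ⟨
            - (e * b) * (- (e * b)) ^ q  ∎
        }
        where
        open ≈-Reasoning setoid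
        open import Algebra.Properties.Ring ring using (-‿involutive)
        e = a ⁻¹⟨ a#0 ⟩
        neg*neg : ∀ x y → - x * - y ≈ x * y
        neg*neg x y = ≈-trans (≈-sym (-‿distribˡ-* x (- y)))
          (≈-trans (-‿cong (≈-sym (-‿distribʳ-* x y))) (-‿involutive _))

  A[P∞] : Group (u ⊔ ℓ) ℓ
  A[P∞] = record
    { Carrier = SymbolA
    ; _≈_     = _≈ᴬ_
    ; _∙_     = _∘ᴬ_
    ; ε       = one
    ; _⁻¹     = inv
    ; isGroup = record
      { isMonoid = record
        { isSemigroup = record
          { isMagma = record
            { isEquivalence = record
              { refl  = ≈-refl , ≈-refl , ≈-refl
              ; sym   = λ (x , y , z) → ≈-sym x , ≈-sym y , ≈-sym z
              ; trans = λ (x , y , z) (x′ , y′ , z′) → ≈-trans x x′ , ≈-trans y y′ , ≈-trans z z′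
              }
            ; ∙-cong = λ (a₁ , b₁ , c₁) (a₂ , b₂ , c₂) →
                *-cong a₁ a₂
              , +-cong (*-cong a₂ b₁) b₂
              , +-cong (+-cong (*-cong (F.^-congˡ (1 ℕ.+ q) a₂) c₁)
                               (*-cong (*-cong a₂ (^q-cong b₂)) b₁)) c₂
            }
          ; assoc = assoc
          }
        ; identity = identityˡ , identityʳ
        }
      ; inverse = inverseˡ , inverseʳ
      ; ⁻¹-cong = λ {x} {y} (a₁ , b₁ , c₁) →
          let e₁ = F.⁻¹-cong (a#0 x) (a#0 y) a₁ in
          e₁ , -‿cong (*-cong e₁ b₁) , *-cong (F.^-congˡ (1 ℕ.+ q) e₁) (^q-cong c₁)
      }
    }
    where
    open SymbolA
    open ≈-Reasoning setoid

    infix 4 _≈ᴬ_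
    _≈ᴬ_ : Rel SymbolA ℓ
    g ≈ᴬ h = a g ≈ a h × b g ≈ b h × c g ≈ c h

    infixl 7 _∘ᴬ_
    -- [a′,b′,c′] ∘ [a,b,c], obtained by applying [a′,b′,c′] to the images of x and y under [a,b,c].
    _∘ᴬ_ : SymbolA → SymbolA → SymbolA
    g′ ∘ᴬ g = record
      { a = a g′ * a g
      ; b = a g * b g′ + b g
      ; c = a g ^ (1 ℕ.+ q) * c g′ + a g * b g ^ q * b g′ + c g
      ; a#0 = F.x#0y#0→xy#0 (a#0 g′) (a#0 g)
      ; curve = closed (a g) (b g) (c g) (b g′) (c g′) (curve g) (curve g′)
      }
      where
      closed : ∀ a b c b′ c′ → c ^ q + c ≈ b ^ (1 ℕ.+ q) → c′ ^ q + c′ ≈ b′ ^ (1 ℕ.+ q) →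
        let c″ = a ^ (1 ℕ.+ q) * c′ + a * b ^ q * b′ + c in
        c″ ^ q + c″ ≈ (a * b′ + b) ^ (1 ℕ.+ q)
      closed a b c b′ c′ curve curve′ = begin
        (a * ā * c′ + a * b̄ * b′ + c) ^ q + (a * ā * c′ + a * b̄ * b′ + c)
          ≈⟨ +-congʳ (≈-trans (^q-homo-+ _ _) (+-congʳ (≈-trans (^q-homo-+ _ _) (+-cong
               (≈-trans (^q-homo-* _ _) (*-congʳ (≈-trans (^q-homo-* _ _) (*-congˡ (^q^q a)))))
               (≈-trans (^q-homo-* _ _) (*-congʳ (≈-trans (^q-homo-* _ _) (*-congˡ (^q^q b))))))))) ⟩
        (ā * a * c̄′ + ā * b * b̄′ + c̄) + (a * ā * c′ + a * b̄ * b′ + c)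
          ≈⟨ solve 10 (λ a ā b b̄ c c̄ b′ b̄′ c′ c̄′ →
               (ā :* a :* c̄′ :+ ā :* b :* b̄′ :+ c̄) :+ (a :* ā :* c′ :+ a :* b̄ :* b′ :+ c) :=
               a :* ā :* (c̄′ :+ c′) :+ (ā :* b :* b̄′ :+ a :* b̄ :* b′) :+ (c̄ :+ c))
               ≈-refl a ā b b̄ c c̄ b′ b̄′ c′ c̄′ ⟩
        a * ā * (c̄′ + c′) + (ā * b * b̄′ + a * b̄ * b′) + (c̄ + c)
          ≈⟨ +-cong (+-congʳ (*-congˡ curve′)) curve ⟩
        a * ā * (b′ * b̄′) + (ā * b * b̄′ + a * b̄ * b′) + b * b̄
          ≈⟨ solve 6 (λ a ā b b̄ b′ b̄′ →
               a :* ā :* (b′ :* b̄′) :+ (ā :* b :* b̄′ :+ a :* b̄ :* b′) :+ b :* b̄ :=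
               (a :* b′ :+ b) :* (ā :* b̄′ :+ b̄)) ≈-refl a ā b b̄ b′ b̄′ ⟩
        (a * b′ + b) * (ā * b̄′ + b̄)
          ≈⟨ *-congˡ (≈-trans (^q-homo-+ _ _) (+-congʳ (^q-homo-* _ _))) ⟨
        (a * b′ + b) * (a * b′ + b) ^ q  ∎
        where
        ā = a ^ q ; b̄ = b ^ q ; c̄ = c ^ q ; b̄′ = b′ ^ q ; c̄′ = c′ ^ q

    one : SymbolA
    one = record
      { a = 1# ; b = 0# ; c = 0# ; a#0 = F.1#0
      ; curve = ≈-trans (+-identityʳ _) (≈-trans 0^q≈0 (≈-sym (zeroˡ _)))
      }

    assoc : ∀ x y z → (x ∘ᴬ y) ∘ᴬ z ≈ᴬ x ∘ᴬ (y ∘ᴬ z)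
    assoc g″ g′ g =
        *-assoc _ _ _
      , solve 5 (λ a b a′ b′ b″ → a :* (a′ :* b″ :+ b′) :+ b := a′ :* a :* b″ :+ (a :* b′ :+ b))
          ≈-refl (a g) (b g) (a g′) (b g′) (b g″)
      , third (a g) (b g) (c g) (a g′) (b g′) (c g′) (b g″) (c g″)
      where
      third : ∀ a b c a′ b′ c′ b″ c″ →
        a ^ (1 ℕ.+ q) * (a′ ^ (1 ℕ.+ q) * c″ + a′ * b′ ^ q * b″ + c′) + a * b ^ q * (a′ * b″ + b′) + c ≈
        (a′ * a) ^ (1 ℕ.+ q) * c″ + a′ * a * (a * b′ + b) ^ q * b″ +
        (a ^ (1 ℕ.+ q) * c′ + a * b ^ q * b′ + c)
      third a b c a′ b′ c′ b″ c″ = begin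
        a * ā * (a′ * ā′ * c″ + a′ * b̄′ * b″ + c′) + a * b̄ * (a′ * b″ + b′) + c
          ≈⟨ solve 12 (λ a ā b b̄ c a′ ā′ b′ b̄′ c′ b″ c″ →
               a :* ā :* (a′ :* ā′ :* c″ :+ a′ :* b̄′ :* b″ :+ c′) :+ a :* b̄ :* (a′ :* b″ :+ b′) :+ c :=
               a′ :* a :* (ā′ :* ā) :* c″ :+ a′ :* a :* (ā :* b̄′ :+ b̄) :* b″ :+
               (a :* ā :* c′ :+ a :* b̄ :* b′ :+ c))
               ≈-refl a ā b b̄ c a′ ā′ b′ b̄′ c′ b″ c″ ⟩
        a′ * a * (ā′ * ā) * c″ + a′ * a * (ā * b̄′ + b̄) * b″ + (a * ā * c′ + a * b̄ * b′ + c)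
          ≈⟨ +-congʳ (+-cong (*-congʳ (*-congˡ (^q-homo-* a′ a)))
               (*-congʳ (*-congˡ (≈-trans (^q-homo-+ _ _) (+-congʳ (^q-homo-* a b′)))))) ⟨
        a′ * a * (a′ * a) ^ q * c″ + a′ * a * (a * b′ + b) ^ q * b″ +
        (a * ā * c′ + a * b̄ * b′ + c)  ∎
        where
        ā = a ^ q ; b̄ = b ^ q ; ā′ = a′ ^ q ; b̄′ = b′ ^ q

    identityˡ : ∀ g → one ∘ᴬ g ≈ᴬ g
    identityˡ g =
        *-identityˡ _
      , ≈-trans (+-congʳ (zeroʳ _)) (+-identityˡ _)
      , ≈-trans (+-congʳ (≈-trans (+-cong (zeroʳ _) (zeroʳ _)) (+-identityˡ _))) (+-identityˡ _)

    identityʳ : ∀ g → g ∘ᴬ one ≈ᴬ g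
    identityʳ g =
        *-identityʳ _
      , ≈-trans (+-identityʳ _) (*-identityˡ _)
      , ≈-trans (+-identityʳ _) (≈-trans (+-cong
          (≈-trans (*-congʳ (F.1^n≈1 (1 ℕ.+ q))) (*-identityˡ _))
          (≈-trans (*-congʳ (≈-trans (*-congˡ 0^q≈0) (zeroʳ _))) (zeroˡ _)))
          (+-identityʳ _))

    e·e̅ : ∀ g → (a g ⁻¹⟨ a#0 g ⟩) * a g ≈ 1#
    e·e̅ g = F.⁻¹-inverseˡ (a#0 g)

    inverseʳ : ∀ g → g ∘ᴬ inv g ≈ᴬ one
    inverseʳ g = F.⁻¹-inverseʳ (a#0 g) , -‿inverseʳ _ , (begin
        e * ē * c g + e * (- (e * b g)) ^ q * b g + e * ē * c g ^ q
          ≈⟨ +-congʳ (+-congˡ (*-congʳ (*-congˡ (≈-trans (^q-homo-neg _) (-‿cong (^q-homo-* _ _)))))) ⟩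
        e * ē * c g + e * (- (ē * b g ^ q)) * b g + e * ē * c g ^ q
          ≈⟨ +-congʳ (+-congˡ (≈-trans (*-congʳ (≈-sym (-‿distribʳ-* _ _))) (≈-sym (-‿distribˡ-* _ _)))) ⟩
        e * ē * c g + - (e * (ē * b g ^ q) * b g) + e * ē * c g ^ q
          ≈⟨ solve 5 (λ e ē c c̄ t → e :* ē :* c :+ t :+ e :* ē :* c̄ := e :* ē :* (c̄ :+ c) :+ t)
               ≈-refl e ē (c g) (c g ^ q) (- (e * (ē * b g ^ q) * b g)) ⟩
        e * ē * (c g ^ q + c g) + - (e * (ē * b g ^ q) * b g)
          ≈⟨ +-congʳ (*-congˡ (curve g)) ⟩
        e * ē * (b g * b g ^ q) + - (e * (ē * b g ^ q) * b g)
          ≈⟨ +-congʳ (solve 4 (λ e ē b b̄ → e :* ē :* (b :* b̄) := e :* (ē :* b̄) :* b) ≈-refl e ē (b g) (b g ^ q)) ⟩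
        e * (ē * b g ^ q) * b g + - (e * (ē * b g ^ q) * b g)
          ≈⟨ -‿inverseʳ _ ⟩
        0# ∎)
      where
      e = a g ⁻¹⟨ a#0 g ⟩
      ē = e ^ q

    inverseˡ : ∀ g → inv g ∘ᴬ g ≈ᴬ one
    inverseˡ g = F.⁻¹-inverseˡ (a#0 g)
      , ≈-trans (+-congʳ a·-eb≈-b) (-‿inverseˡ _)
      , (begin
        a g * a g ^ q * (e * e ^ q * c g ^ q) + a g * b g ^ q * - (e * b g) + c g
          ≈⟨ +-congʳ (+-cong
               (solve 5 (λ a ā e ē c̄ → a :* ā :* (e :* ē :* c̄) := (a :* e) :* (ā :* ē) :* c̄)
                 ≈-refl (a g) (a g ^ q) e (e ^ q) (c g ^ q))
               (solve 3 (λ a b̄ t → a :* b̄ :* t := b̄ :* (a :* t)) ≈-refl (a g) (b g ^ q) (- (e * b g)))) ⟩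
        (a g * e) * (a g ^ q * e ^ q) * c g ^ q + b g ^ q * (a g * - (e * b g)) + c g
          ≈⟨ +-congʳ (+-cong
               (≈-trans (*-congʳ (≈-trans (*-cong ae≈1
                 (≈-trans (≈-sym (^q-homo-* _ _)) (≈-trans (^q-cong ae≈1) (F.1^n≈1 q)))) (*-identityˡ _))) (*-identityˡ _))
               (≈-trans (*-congˡ a·-eb≈-b) (≈-sym (-‿distribʳ-* _ _)))) ⟩
        c g ^ q + - (b g ^ q * b g) + c g
          ≈⟨ solve 3 (λ c̄ t c → c̄ :+ t :+ c := c̄ :+ c :+ t) ≈-refl (c g ^ q) (- (b g ^ q * b g)) (c g) ⟩
        c g ^ q + c g + - (b g ^ q * b g)
          ≈⟨ +-congʳ (≈-trans (curve g) (*-comm _ _)) ⟩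
        b g ^ q * b g + - (b g ^ q * b g)
          ≈⟨ -‿inverseʳ _ ⟩
        0# ∎)
      where
      e = a g ⁻¹⟨ a#0 g ⟩
      ae≈1 : a g * e ≈ 1#
      ae≈1 = F.⁻¹-inverseʳ (a#0 g)
      a·-eb≈-b : a g * - (e * b g) ≈ - b g
      a·-eb≈-b = ≈-trans (≈-sym (-‿distribʳ-* _ _)) (-‿cong
        (≈-trans (≈-sym (*-assoc _ _ _)) (≈-trans (*-congʳ ae≈1) (*-identityˡ _))))

  𝔽ˣ : Group (u ⊔ ℓ) ℓ
  𝔽ˣ = record
    { Carrier = ∃[ a ] a # 0#
    ; _≈_     = λ x y → proj₁ x ≈ proj₁ y
    ; _∙_     = λ (x , x#0) (y , y#0) → x * y , F.x#0y#0→xy#0 x#0 y#0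
    ; ε       = 1# , F.1#0
    ; _⁻¹     = λ (x , x#0) → x ⁻¹⟨ x#0 ⟩ , F.⁻¹-#0 x#0
    ; isGroup = record
      { isMonoid = record
        { isSemigroup = record
          { isMagma = record
            { isEquivalence = record { refl = ≈-refl ; sym = ≈-sym ; trans = ≈-trans }
            ; ∙-cong        = *-cong
            }
          ; assoc = λ _ _ _ → *-assoc _ _ _
          }
        ; identity = (λ _ → *-identityˡ _) , (λ _ → *-identityʳ _)
        }
      ; inverse = (λ (_ , x#0) → F.⁻¹-inverseˡ x#0) , (λ (_ , x#0) → F.⁻¹-inverseʳ x#0)
      ; ⁻¹-cong = λ {x} {y} → F.⁻¹-cong (proj₂ x) (proj₂ y)
      }
    }

  φ : Group.Carrier A[P∞] → Group.Carrier 𝔽ˣ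
  φ g = SymbolA.a g , SymbolA.a#0 g

  φ-homo : IsGroupHomomorphism (Group.rawGroup A[P∞]) (Group.rawGroup 𝔽ˣ) φ
  φ-homo = record
    { isMonoidHomomorphism = record
      { isMagmaHomomorphism = record
        { isRelHomomorphism = record { cong = proj₁ }
        ; homo = λ _ _ → ≈-refl
        }
      ; ε-homo = ≈-refl
      }
    ; ⁻¹-homo = λ _ → ≈-refl
    }

  μ : Group (u ⊔ ℓ) ℓ
  μ = record
    { Carrier = ∃[ d ] d K.^ |μ| K.≈ K.1#
    ; _≈_     = λ x y → proj₁ x K.≈ proj₁ y
    ; _∙_     = λ (x , xᴺ≈1) (y , yᴺ≈1) → x K.* y ,
        K.trans (K.^-distrib-* x y |μ|) (K.trans (K.*-cong xᴺ≈1 yᴺ≈1) (K.*-identityˡ _))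
    ; ε       = K.1# , K.1^n≈1 |μ|
    ; _⁻¹     = λ (x , xᴺ≈1) → x K.^ (|μ| ∸ 1) ,
        K.trans (K.^-assocʳ x (|μ| ∸ 1) |μ|)
          (K.trans (K.^-congʳ x (ℕ.*-comm (|μ| ∸ 1) |μ|))
            (K.trans (K.sym (K.^-assocʳ x |μ| (|μ| ∸ 1)))
              (K.trans (K.^-congˡ (|μ| ∸ 1) xᴺ≈1) (K.1^n≈1 (|μ| ∸ 1)))))
    ; isGroup = record
      { isMonoid = record
        { isSemigroup = record
          { isMagma = record
            { isEquivalence = record { refl = K.refl ; sym = K.sym ; trans = K.trans }
            ; ∙-cong        = K.*-cong
            }
          ; assoc = λ _ _ _ → K.*-assoc _ _ _
          }
        ; identity = (λ _ → K.*-identityˡ _) , (λ _ → K.*-identityʳ _)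
        }
      ; inverse = (λ x → K.trans (K.*-comm _ _) (inverseʳ x)) , inverseʳ
      ; ⁻¹-cong = K.^-congˡ (|μ| ∸ 1)
      }
    }
    where
    inverseʳ : (x : ∃[ d ] d K.^ |μ| K.≈ K.1#) → proj₁ x K.* proj₁ x K.^ (|μ| ∸ 1) K.≈ K.1#
    inverseʳ (x , xᴺ≈1) = K.trans (K.^-congʳ x suc[|μ|-1]≡|μ|) xᴺ≈1

  private
    module A = Group A[P∞]
    module μ = Group μ
    module ι = IsRingMonomorphism ι-mono

  ι-homo-^ : ∀ x j → ι (x ^ j) K.≈ ι x K.^ j
  ι-homo-^ x zero    = ι.1#-homo
  ι-homo-^ x (suc j) = K.trans (ι.*-homo _ _) (K.*-congˡ (ι-homo-^ x j))

  -- The symbol [a,b,c,d], stored as [a,b,c] together with d, stands for the automorphism of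
  -- 𝕂(x,y,z) that acts on x and y as [a,b,c] does and sends z to d z; distinct symbols give
  -- distinct automorphisms, so B(Q∞) is the group of these symbols.
  record SymbolB : Set (u ⊔ ℓ) where
    field
      abc  : SymbolA
      d    : K.Carrier
      root : d K.^ m K.≈ ι (SymbolA.a abc)

  π : SymbolB → A.Carrier
  π = SymbolB.abc

  abstract
    d∈μ : (g : SymbolB) → SymbolB.d g K.^ |μ| K.≈ K.1#
    d∈μ g = begin
      d K.^ |μ|                                      ≈⟨ K.^-congʳ d (≡.cong (ℕ._* (q ∸ 1)) m*[1+q]≡qⁿ+1) ⟨
      d K.^ (m ℕ.* (1 ℕ.+ q) ℕ.* (q ∸ 1))            ≈⟨ K.^-congʳ d (ℕ.*-assoc m (1 ℕ.+ q) (q ∸ 1)) ⟩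
      d K.^ (m ℕ.* ((1 ℕ.+ q) ℕ.* (q ∸ 1)))          ≈⟨ K.^-assocʳ d m _ ⟨
      (d K.^ m) K.^ ((1 ℕ.+ q) ℕ.* (q ∸ 1))          ≈⟨ K.^-congˡ ((1 ℕ.+ q) ℕ.* (q ∸ 1)) root ⟩
      ι a K.^ ((1 ℕ.+ q) ℕ.* (q ∸ 1))                ≈⟨ ι-homo-^ a ((1 ℕ.+ q) ℕ.* (q ∸ 1)) ⟨
      ι (a ^ ((1 ℕ.+ q) ℕ.* (q ∸ 1)))                ≈⟨ ι.⟦⟧-cong (a#0⇒a^[q²-1]≈1 a#0) ⟩
      ι 1#                                           ≈⟨ ι.1#-homo ⟩
      K.1#                                           ∎
      where
      open SymbolB g
      open SymbolA abc
      open ≈-Reasoning K.setoid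

  π-d : SymbolB → μ.Carrier
  π-d g = SymbolB.d g , d∈μ g

  B[Q∞] : Group (u ⊔ ℓ) ℓ
  B[Q∞] = record
    { Carrier = SymbolB
    ; _≈_     = λ g h → π g A.≈ π h × d g K.≈ d h
    ; _∙_     = λ g′ g → record
      { abc  = π g′ A.∙ π g
      ; d    = d g′ K.* d g
      ; root = K.trans (K.^-distrib-* _ _ m)
          (K.trans (K.*-cong (root g′) (root g)) (K.sym (ι.*-homo _ _)))
      }
    ; ε       = record { abc = A.ε ; d = K.1# ; root = K.trans (K.1^n≈1 m) (K.sym ι.1#-homo) }
    ; _⁻¹     = λ g → record
      { abc  = π g A.⁻¹
      ; d    = d g K.^ (|μ| ∸ 1)
      ; root = root⁻¹ g
      }
    ; isGroup = record
      { isMonoid = record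
        { isSemigroup = record
          { isMagma = record
            { isEquivalence = record
              { refl  = λ {g} → A.refl {π g} , K.refl
              ; sym   = λ {g} {h} (x , y) → A.sym {π g} {π h} x , K.sym y
              ; trans = λ {g} {h} {j} (x , y) (x′ , y′) → A.trans {π g} {π h} {π j} x x′ , K.trans y y′
              }
            ; ∙-cong = λ {g} {g′} {h} {h′} (x , y) (x′ , y′) →
                A.∙-cong {π g} {π g′} {π h} {π h′} x x′ , K.*-cong y y′
            }
          ; assoc = λ g h j → A.assoc (π g) (π h) (π j) , K.*-assoc _ _ _
          }
        ; identity = (λ g → A.identityˡ (π g) , K.*-identityˡ _) , (λ g → A.identityʳ (π g) , K.*-identityʳ _)
        }
      ; inverse = (λ g → A.inverseˡ (π g) , μ.inverseˡ (π-d g)) , (λ g → A.inverseʳ (π g) , μ.inverseʳ (π-d g))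
      ; ⁻¹-cong = λ {g} {h} (x , y) → A.⁻¹-cong {π g} {π h} x , K.^-congˡ (|μ| ∸ 1) y
      }
    }
    where
    open SymbolB
    root⁻¹ : ∀ g → proj₁ (π-d g μ.⁻¹) K.^ m K.≈ ι (SymbolA.a (π g A.⁻¹))
    root⁻¹ g = K.*-cancelˡ dᵐ#0 (begin
      d g K.^ m K.* e K.^ m                                    ≈⟨ K.^-distrib-* (d g) e m ⟨
      (d g K.* e) K.^ m                                        ≈⟨ K.^-congˡ m (μ.inverseʳ (π-d g)) ⟩
      K.1# K.^ m                                               ≈⟨ K.1^n≈1 m ⟩
      K.1#                                                     ≈⟨ ιa*ιa⁻¹ ⟨
      ι (SymbolA.a (π g)) K.* ι (SymbolA.a (π g A.⁻¹))         ≈⟨ K.*-congʳ (root g) ⟨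
      d g K.^ m K.* ι (SymbolA.a (π g A.⁻¹))                   ∎)
      where
      open ≈-Reasoning K.setoid
      e = d g K.^ (|μ| ∸ 1)
      dᵐ#0 : d g K.^ m K.# K.0#
      dᵐ#0 = K.^-#0 m (K.yx≈1⇒x#0 (μ.inverseˡ (π-d g)))
      ιa*ιa⁻¹ : ι (SymbolA.a (π g)) K.* ι (SymbolA.a (π g A.⁻¹)) K.≈ K.1#
      ιa*ιa⁻¹ = K.trans (K.sym (ι.*-homo _ _))
        (K.trans (ι.⟦⟧-cong (F.⁻¹-inverseʳ (SymbolA.a#0 (π g)))) ι.1#-homo)

  π-homo : IsGroupHomomorphism (Group.rawGroup B[Q∞]) A.rawGroup π
  π-homo = record
    { isMonoidHomomorphism = record
      { isMagmaHomomorphism = record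
        { isRelHomomorphism = record { cong = proj₁ }
        ; homo = λ g h → A.refl {π g A.∙ π h}
        }
      ; ε-homo = A.refl {A.ε}
      }
    ; ⁻¹-homo = λ g → A.refl {π g A.⁻¹}
    }

  π-d-homo : IsGroupHomomorphism (Group.rawGroup B[Q∞]) μ.rawGroup π-d
  π-d-homo = record
    { isMonoidHomomorphism = record
      { isMagmaHomomorphism = record
        { isRelHomomorphism = record { cong = proj₂ }
        ; homo = λ _ _ → K.refl
        }
      ; ε-homo = K.refl
      }
    ; ⁻¹-homo = λ _ → K.refl
    }

  -- { d^m : d ∈ M } and φ(H) are compared as subsets of 𝕂, where ι identifies 𝔽 with a subfield.
  _^ᵐ : Subgroup μ (u ⊔ ℓ) → Pred K.Carrier (u ⊔ ℓ)
  (M ^ᵐ) y = ∃[ x ] (Member M x × proj₁ x K.^ m K.≈ y)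

  φ[_] : Subgroup A[P∞] (u ⊔ ℓ) → Pred K.Carrier (u ⊔ ℓ)
  φ[ H ] y = ∃[ x ] (Member (image A[P∞] 𝔽ˣ φ φ-homo H) x × ι (proj₁ x) K.≈ y)

  record Σ-Pair : Set (lsuc (u ⊔ ℓ)) where
    field
      H          : Subgroup A[P∞] (u ⊔ ℓ)
      M          : Subgroup μ (u ⊔ ℓ)
      compatible : (M ^ᵐ) ≐ φ[ H ]

  infix 4 _≈ᴾ_
  _≈ᴾ_ : Rel Σ-Pair (u ⊔ ℓ)
  P ≈ᴾ P′ = H P ≈ˢ H P′ × M P ≈ˢ M P′
    where open Σ-Pair

  Ξ : Subgroup B[Q∞] (u ⊔ ℓ) → Σ-Pair
  Ξ G = record
    { H = image B[Q∞] A[P∞] π π-homo G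
    ; M = image B[Q∞] μ π-d π-d-homo G
    ; compatible =
        (λ { (x , (g , g∈G , d≈x) , xᵐ≈y) →
           φ (π g) , (π g , (g , g∈G , A.refl {π g}) , ≈-refl) ,
           K.trans (K.sym (SymbolB.root g)) (K.trans (K.^-congˡ m d≈x) xᵐ≈y) })
      , (λ { (a , (h , (g , g∈G , πg≈h) , φh≈a) , ιa≈y) →
           π-d g , (g , g∈G , K.refl) ,
           K.trans (SymbolB.root g) (K.trans (ι.⟦⟧-cong (≈-trans (proj₁ πg≈h) φh≈a)) ιa≈y) })
    }

{-# OPTIONS --safe #-}
module Submission where

open import Defs
open import Level using (Level; _⊔_)
open import Algebra.Bundles using (Group)
open import Algebra.Morphism.Structures using (IsRingMonomorphism)
import Algebra.Properties.Monoid.Mult as Multiples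
open import Data.Nat using (ℕ; zero; suc; _≤_; _<_; _^_; _*_; >-nonZero)
import Data.Nat.Properties as ℕ
open import Data.Nat.Divisibility using (_∣_)
open import Data.Nat.Primality using (Prime)
open import Data.Product.Base using (_×_; _,_; proj₁; proj₂)
open import Function.Structures using (IsBijection)
open import Relation.Binary.PropositionalEquality using (_≡_; subst)
open import Relation.Binary.Structures using (IsEquivalence)
import Relation.Binary.Reasoning.Setoid as ≈-Reasoning
open import Relation.Nullary using (¬_)

-- B(Q∞) is the fibre product of A(P∞) and μ over 𝔽ˣ, so the preimage under Ξ of a pair (H,M)
-- can only be { g | π g ∈ H, d g ∈ M }.  That Ξ G determines G comes down to the following: the
-- kernel of φ is annihilated by N² for N = |𝕂| = q²ⁿ, being an extension of one group killed by
-- N by another, whereas d^N = d for all d in 𝕂.  Thus raising an element ([1,b,c],d) of G to the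
-- power N² shows that G contains ([1,0,0],d).

private variable
  u ℓ r : Level

module _ {G : Group u ℓ} where
  open Group G using (monoid)
  open Multiples monoid using () renaming (_×_ to _·_)

  ≈ˢ-isEquivalence : IsEquivalence (_≈ˢ_ {r = r} {G = G})
  ≈ˢ-isEquivalence = record
    { refl  = (λ x∈H → x∈H) , (λ x∈H → x∈H)
    ; sym   = λ (H⊆K , K⊆H) → K⊆H , H⊆K
    ; trans = λ (H⊆K , K⊆H) (K⊆L , L⊆K) → (λ x∈H → K⊆L (H⊆K x∈H)) , (λ x∈L → K⊆H (L⊆K x∈L))
    }

  multiple-closed : (S : Subgroup G r) → ∀ j {x} → Member S x → Member S (j · x)
  multiple-closed S zero    x∈S = ε-closed S
  multiple-closed S (suc j) x∈S = ∙-closed S x∈S (multiple-closed S j x∈S)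

module _ {N} (𝔽 : FiniteField u ℓ N) where
  open FiniteField 𝔽 renaming (_*_ to _·_; _^_ to _↑_)
  open FiniteFieldProperties 𝔽

  -- Multiples of `x` are products with multiples of `1#`, and `j ↦ j ⋆ 1#` turns powers into
  -- powers, so `N ⋆ 1# ≈ 0#` suffices once the exponent is positive.
  Nⁿ⋆x≈0 : ∀ {n} → 0 < n → ∀ x → (N ^ n) ⋆ x ≈ 0#
  Nⁿ⋆x≈0 {n} 0<n x = begin
    (N ^ n) ⋆ x           ≈⟨ ⋆-congʳ (N ^ n) (*-identityˡ x) ⟨
    (N ^ n) ⋆ (1# · x)    ≈⟨ ⋆-assoc-* (N ^ n) 1# x ⟨
    (N ^ n) ⋆ 1# · x      ≈⟨ *-congʳ (⋆1-homo-^ N n) ⟩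
    (N ⋆ 1#) ↑ n · x      ≈⟨ *-congʳ (trans (^-congˡ n N⋆1≈0) (0^n≈0 0<n)) ⟩
    0# · x                ≈⟨ zeroˡ x ⟩
    0#                    ∎
    where open ≈-Reasoning setoid

module _
  {p k q n : ℕ} (p-prime : Prime p) (1≤k : 1 ≤ k) (q≡pᵏ : q ≡ p ^ k) (1≤n : 1 ≤ n) (n-odd : ¬ 2 ∣ n)
  (𝔽 : FiniteField u ℓ (q ^ 2)) (𝕂 : FiniteField u ℓ (q ^ (2 * n)))
  (ι : FiniteField.Carrier 𝔽 → FiniteField.Carrier 𝕂)
  (ι-mono : IsRingMonomorphism (FiniteField.rawRing 𝔽) (FiniteField.rawRing 𝕂) ι)
  where

  open HermitianTower p-prime 1≤k q≡pᵏ n-odd 𝔽 𝕂 ι ι-mono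

  private
    module F where
      open FiniteField 𝔽 public
      open FiniteFieldProperties 𝔽 public
    module K where
      open FiniteField 𝕂 public
      open FiniteFieldProperties 𝕂 public
    module ι = IsRingMonomorphism ι-mono
    module A = Group A[P∞]
    module μ = Group μ
    module B = Group B[Q∞]
    open SymbolA using (a; b; c)
    open SymbolB using (d; root)
    open Multiples B.monoid using () renaming (_×_ to _·_)

    N : ℕ
    N = q ^ (2 * n)

  -- The size of 𝕂 is the `n`-th power of the size of 𝔽, so one number `N` serves both as an
  -- additive annihilator of 𝔽 and as a Frobenius exponent fixing 𝕂.
  N⋆x≈0 : ∀ x → N F.⋆ x F.≈ F.0#
  N⋆x≈0 x = subst (λ j → j F.⋆ x F.≈ F.0#) (ℕ.^-*-assoc q 2 n) (Nⁿ⋆x≈0 𝔽 1≤n x)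

  dᴺ≈d : ∀ x → x K.^ N K.≈ x
  dᴺ≈d = K.xᴺ≈x (ℕ.m^n>0 q {{>-nonZero 0<q}} (2 * n))

  d-multiple : ∀ j g → d (j · g) K.≈ d g K.^ j
  d-multiple zero    g = K.refl
  d-multiple (suc j) g = K.*-congˡ (d-multiple j g)

  module _ {g : SymbolB} (a≈1 : a (π g) F.≈ F.1#) where

    a-multiple : ∀ j → a (π (j · g)) F.≈ F.1#
    a-multiple zero    = F.refl
    a-multiple (suc j) = F.trans (F.*-cong a≈1 (a-multiple j)) (F.*-identityˡ _)

    b-multiple : ∀ j → b (π (j · g)) F.≈ j F.⋆ b (π g)
    b-multiple zero    = F.refl
    b-multiple (suc j) =
      F.+-cong (F.trans (F.*-congʳ (a-multiple j)) (F.*-identityˡ _)) (b-multiple j)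

    -- In general the group law adds to `c` a cross term with factor `b (π g)`. Only where this
    -- vanishes is `c` additive.
    c-multiple : b (π g) F.≈ F.0# → ∀ j → c (π (j · g)) F.≈ j F.⋆ c (π g)
    c-multiple b≈0 zero    = F.refl
    c-multiple b≈0 (suc j) = F.+-cong
      (F.trans
        (F.+-cong
          (F.trans (F.*-congʳ (F.trans (F.^-congˡ (suc q) (a-multiple j)) (F.1^n≈1 (suc q)))) (F.*-identityˡ _))
          (F.trans (F.*-congˡ b≈0) (F.zeroʳ _)))
        (F.+-identityʳ _))
      (c-multiple b≈0 j)

  -- The first multiplication by `N` clears `b`, which makes `c` additive, so the second clears `c`.
  -- Each one raises `d` to the power `N` and thus fixes it.
  N²-multiple : ∀ g → a (π g) F.≈ F.1# →
                π (N · (N · g)) A.≈ A.ε × d (N · (N · g)) K.≈ d g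
  N²-multiple g a≈1 =
      ( a-multiple {N · g} aᴺ≈1 N
      , F.trans (b-multiple {N · g} aᴺ≈1 N) (N⋆x≈0 (b (π (N · g))))
      , F.trans (c-multiple {N · g} aᴺ≈1 bᴺ≈0 N) (N⋆x≈0 (c (π (N · g)))))
    , K.trans (d-N-multiple (N · g)) (d-N-multiple g)
    where
    aᴺ≈1 : a (π (N · g)) F.≈ F.1#
    aᴺ≈1 = a-multiple {g} a≈1 N

    bᴺ≈0 : b (π (N · g)) F.≈ F.0#
    bᴺ≈0 = F.trans (b-multiple {g} a≈1 N) (N⋆x≈0 (b (π g)))

    d-N-multiple : ∀ h → d (N · h) K.≈ d h
    d-N-multiple h = K.trans (d-multiple N h) (dᴺ≈d (d h))

  d≈⇒a≈ : ∀ g h → d g K.≈ d h → a (π g) F.≈ a (π h)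
  d≈⇒a≈ g h dg≈dh = ι.injective
    (K.trans (K.sym (root g)) (K.trans (K.^-congˡ m dg≈dh) (root h)))

  -- The two hypotheses provide `x` in `G` with the right [a,b,c] and `y` in `G` with the right d.
  -- It remains to correct the d of `x` by an element of `G` lying over the identity of A(P∞).
  π∈∧π-d∈⇒∈ : (G : Subgroup B[Q∞] (u ⊔ ℓ)) → ∀ g →
              Member (image B[Q∞] A[P∞] π π-homo G) (π g) →
              Member (image B[Q∞] μ π-d π-d-homo G) (π-d g) → Member G g
  π∈∧π-d∈⇒∈ G g (x , x∈G , πx≈πg) (y , y∈G , dy≈dg) =
    resp G {x B.∙ v} {g} (π-xv≈ , d-xv≈) (∙-closed G {x} {v} x∈G
      (multiple-closed G N {N · w} (multiple-closed G N {w}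
        (∙-closed G {x B.⁻¹} {y} (⁻¹-closed G {x} x∈G) y∈G))))
    where
    -- `w` carries the missing factor `d y / d x`. Its `a` is 1 because `y` agrees with `g` in `d`,
    -- hence in `a`, and so does `x`. Passing to `v` clears `b` and `c` and keeps `d`.
    w v : SymbolB
    w = x B.⁻¹ B.∙ y
    v = N · (N · w)

    aw≈1 : a (π w) F.≈ F.1#
    aw≈1 = F.trans
      (F.*-congˡ (F.trans (d≈⇒a≈ y g dy≈dg) (F.sym (proj₁ πx≈πg))))
      (proj₁ (A.inverseˡ (π x)))

    π-xv≈ : π (x B.∙ v) A.≈ π g
    π-xv≈ = A.trans {π (x B.∙ v)} {π x A.∙ A.ε} {π g}
      (A.∙-cong {π x} {π x} {π v} {A.ε} (A.refl {π x}) (proj₁ (N²-multiple w aw≈1)))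
      (A.trans {π x A.∙ A.ε} {π x} {π g} (A.identityʳ (π x)) πx≈πg)

    d-xv≈ : d (x B.∙ v) K.≈ d g
    d-xv≈ = begin
      d x K.* d v                   ≈⟨ K.*-congˡ (proj₂ (N²-multiple w aw≈1)) ⟩
      d x K.* (d (x B.⁻¹) K.* d y)  ≈⟨ K.*-assoc _ _ _ ⟨
      d x K.* d (x B.⁻¹) K.* d y    ≈⟨ K.*-congʳ (μ.inverseʳ (π-d x)) ⟩
      K.1# K.* d y                  ≈⟨ K.*-identityˡ _ ⟩
      d y                           ≈⟨ dy≈dg ⟩
      d g                           ∎
      where open ≈-Reasoning K.setoid

  ≈ᴾ-isEquivalence : IsEquivalence _≈ᴾ_
  ≈ᴾ-isEquivalence = record
    { refl  = λ {P} → ≈ᴬ.refl {H P} , ≈ᵘ.refl {M P}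
    ; sym   = λ {P} {P′} (H≈ , M≈) → ≈ᴬ.sym {H P} {H P′} H≈ , ≈ᵘ.sym {M P} {M P′} M≈
    ; trans = λ {P} {P′} {P″} (H≈ , M≈) (H≈′ , M≈′) →
        ≈ᴬ.trans {H P} {H P′} {H P″} H≈ H≈′ , ≈ᵘ.trans {M P} {M P′} {M P″} M≈ M≈′
    }
    where
    open Σ-Pair
    module ≈ᴬ = IsEquivalence (≈ˢ-isEquivalence {G = A[P∞]})
    module ≈ᵘ = IsEquivalence (≈ˢ-isEquivalence {G = μ})

  Ξ-cong : ∀ {G G′} → G ≈ˢ G′ → Ξ G ≈ᴾ Ξ G′
  Ξ-cong (G⊆G′ , G′⊆G) =
      ( (λ (g , g∈G , eq) → g , G⊆G′ g∈G , eq) , (λ (g , g∈G′ , eq) → g , G′⊆G g∈G′ , eq))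
    , ( (λ (g , g∈G , eq) → g , G⊆G′ g∈G , eq) , (λ (g , g∈G′ , eq) → g , G′⊆G g∈G′ , eq))

  Ξ-injective : ∀ {G G′} → Ξ G ≈ᴾ Ξ G′ → G ≈ˢ G′
  Ξ-injective {G} {G′} ((πG⊆ , πG′⊆) , (dG⊆ , dG′⊆)) =
      (λ {g} g∈G → π∈∧π-d∈⇒∈ G′ g (πG⊆ {π g} (g , g∈G , A.refl {π g})) (dG⊆ {π-d g} (g , g∈G , K.refl)))
    , (λ {g} g∈G′ → π∈∧π-d∈⇒∈ G g (πG′⊆ {π g} (g , g∈G′ , A.refl {π g})) (dG′⊆ {π-d g} (g , g∈G′ , K.refl)))

  fibreProduct : Subgroup A[P∞] (u ⊔ ℓ) → Subgroup μ (u ⊔ ℓ) → Subgroup B[Q∞] (u ⊔ ℓ)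
  fibreProduct H M = record
    { Member    = λ g → Member H (π g) × Member M (π-d g)
    ; resp      = λ {g} {h} (πg≈πh , dg≈dh) (πg∈H , dg∈M) →
        resp H {π g} {π h} πg≈πh πg∈H , resp M {π-d g} {π-d h} dg≈dh dg∈M
    -- Both elements of `μ` have the same underlying root of unity but different proofs of being
    -- one, so membership is transported along `K.refl`; likewise for products and inverses.
    ; ε-closed  = ε-closed H , resp M {μ.ε} {π-d B.ε} K.refl (ε-closed M)
    ; ∙-closed  = λ {g} {h} (πg∈H , dg∈M) (πh∈H , dh∈M) →
        ∙-closed H {π g} {π h} πg∈H πh∈H
      , resp M {π-d g μ.∙ π-d h} {π-d (g B.∙ h)} K.refl (∙-closed M {π-d g} {π-d h} dg∈M dh∈M)
    ; ⁻¹-closed = λ {g} (πg∈H , dg∈M) →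
        ⁻¹-closed H {π g} πg∈H
      , resp M {π-d g μ.⁻¹} {π-d (g B.⁻¹)} K.refl (⁻¹-closed M {π-d g} dg∈M)
    }

  Ξ-fibreProduct : (P : Σ-Pair) → Ξ (fibreProduct (Σ-Pair.H P) (Σ-Pair.M P)) ≈ᴾ P
  Ξ-fibreProduct P =
      ( (λ (g , (πg∈H , _) , πg≈h) → resp H πg≈h πg∈H)
      , (λ {h} h∈H →
          -- φ(H) ⊆ M^m provides an m-th root in `M` that lifts `h` to B(Q∞).
          let (x , x∈M , xᵐ≈ιa) = proj₂ compatible (φ h , (h , h∈H , F.refl) , K.refl)
          in record { abc = h ; d = proj₁ x ; root = xᵐ≈ιa }
           , (h∈H , resp M K.refl x∈M) , A.refl {h}))
    , ( (λ (g , (_ , dg∈M) , dg≈x) → resp M dg≈x dg∈M)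
      , (λ {x} x∈M →
          -- Conversely, M^m ⊆ φ(H) provides a symbol in `H` whose `a` is the m-th power of `x`.
          let (e , (h , h∈H , φh≈e) , ιe≈xᵐ) = proj₁ compatible (x , x∈M , K.refl)
          in record { abc = h ; d = proj₁ x
                    ; root = K.sym (K.trans (ι.⟦⟧-cong φh≈e) ιe≈xᵐ) }
           , (h∈H , resp M K.refl x∈M) , K.refl))
    where open Σ-Pair P

  Ξ-isBijection : IsBijection (_≈ˢ_ {G = B[Q∞]}) _≈ᴾ_ Ξ
  Ξ-isBijection = record
    { isInjection = record
      { isCongruent = record
        { cong           = λ {G} {G′} → Ξ-cong {G} {G′}
        ; isEquivalence₁ = ≈ˢ-isEquivalence {G = B[Q∞]}
        ; isEquivalence₂ = ≈ᴾ-isEquivalence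
        }
      ; injective = λ {G} {G′} → Ξ-injective {G} {G′}
      }
    -- Surjectivity over setoids asks that every `G′` equal to the chosen preimage be sent to `P`,
    -- hence the use of `Ξ-cong`.
    ; surjective = λ P → let G = fibreProduct (Σ-Pair.H P) (Σ-Pair.M P) in G , λ {G′} G′≈G →
        IsEquivalence.trans ≈ᴾ-isEquivalence {Ξ G′} {Ξ G} {P} (Ξ-cong {G′} {G} G′≈G) (Ξ-fibreProduct P)
    }

theorem3p5 : ∀ {u ℓ} (p k q n : ℕ) (p-prime : Prime p) (1≤k : 1 ≤ k) (q≡pᵏ : q ≡ p ^ k)
    (1≤n : 1 ≤ n) (n-odd : ¬ 2 ∣ n)
    (𝔽 : FiniteField u ℓ (q ^ 2)) (𝕂 : FiniteField u ℓ (q ^ (2 * n)))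
    (ι : FiniteField.Carrier 𝔽 → FiniteField.Carrier 𝕂)
    (ι-mono : IsRingMonomorphism (FiniteField.rawRing 𝔽) (FiniteField.rawRing 𝕂) ι) →
    let open HermitianTower p-prime 1≤k q≡pᵏ n-odd 𝔽 𝕂 ι ι-mono in
    IsBijection (_≈ˢ_ {G = B[Q∞]}) _≈ᴾ_ Ξ
theorem3p5 p k q n p-prime 1≤k q≡pᵏ 1≤n n-odd 𝔽 𝕂 ι ι-mono =
  Ξ-isBijection p-prime 1≤k q≡pᵏ 1≤n n-odd 𝔽 𝕂 ι ι-mono
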